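{- Let $G$ be a connected threshold graph with vertices $1,\dots,n$ (in the order of its construction as a threshold graph), and let $k+1$ be the number of distinct eigenvalues of its Laplacian. Then for every $1\le t\le k-1$, the singleton $\{n\}$ is a uniformly weighted design of $G$ of strength $t$. In other words, for every $1\le t\le k-1$ the eigenconfiguration $\mathcal{B}_t$ of $G$ is $2$-valued.
   Context: A threshold graph is a graph with vertices $1,\dots,n$ such that each vertex $i$ is either connected to all vertices before it (a dominating vertex) or to none of the vertices before it (an isolated vertex). The Laplacian $L$ of a graph on $[n]=\{1,\dots,n\}$ is the $n\times n$ matrix with $L_{ii}=\deg(i)$, $L_{ij}=-1$ if $\{i,j\}$ is an edge, and $L_{ij}=0$ otherwise. Let $0=\lambda_0<\lambda_1<\cdots<\lambda_k$ be its distinct eigenvalues, with eigenspaces $E_0,\dots,E_k\subset\mathbb{R}^n$ (vectors are viewed as functions $[n]\to\mathbb{R}$). A subset $W\subset[n]$ with weights $a_w\in\mathbb{R}$ ($w\in W$) averages $f:[n]\to\mathbb{R}$ if $\frac1n\sum_{v\in[n]}f(v)=\sum_{w\in W}a_wf(w)$. It is a graphical design of strength $t$ if it averages every $f\in E_0\oplus\cdots\oplus E_t$, and it is uniformly weighted if there is $a>0$ with $a_w=a$ for all $w\in W$; a set $W$ is called a uniformly weighted design of strength $t$ if it is one for some such $a$. Let $\beta=\sum_{i=t+1}^k\dim E_i$ and let $B\in\mathbb{R}^{\beta\times n}$ be a matrix whose rows are the union of chosen bases of $E_{t+1},\dots,E_k$. The $t$-th eigenconfiguration $\mathcal{B}_t=\{b_1,\dots,b_n\}\subset\mathbb{R}^\beta$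 is the multiset of columns of $B$ (the choice of bases is arbitrary). A point configuration in $\mathbb{R}^d$ not contained in an affine hyperplane is $2$-valued if there is a linear functional $a^\top x$ taking exactly two values on its points. -}

module Defs where

open import Level using (Level; 0ℓ; _⊔_) renaming (suc to lsuc)
open import Algebra.Apartness.Bundles using (HeytingField)
open import Algebra.Bundles using (CommutativeRing)
import Algebra.Definitions.RawMonoid as RawMonoidDefs
open import Data.Bool.Base using (if_then_else_)
open import Data.Fin.Base using (Fin; zero; suc; toℕ) renaming (_<_ to _<ᶠ_)
import Data.Fin.Properties as Fin
open import Data.Fin.Subset using (Subset; ∣_∣; _∈_)
open import Data.Fin.Subset.Properties using (_∈?_)
open import Data.Nat.Base as ℕ using (ℕ; zero; suc; NonZero)
open import Data.Product.Base using (Σ; Σ-syntax; ∃; ∃-syntax; _×_; _,_; proj₁; proj₂)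
open import Data.Sum.Base using (_⊎_; inj₁; inj₂)
import Data.Vec.Base as Vec
open import Data.Vec.Functional using (Vector)
open import Function.Bundles using (_↔_; module Inverse)
open import Relation.Binary.Core using (Rel)
open import Relation.Binary.Construct.Closure.ReflexiveTransitive using (Star)
open import Relation.Binary.Definitions using (Symmetric; Irreflexive; Decidable)
open import Relation.Binary.PropositionalEquality.Core using (_≡_)
open import Relation.Binary.Structures using (IsStrictPartialOrder)
open import Relation.Nullary.Decidable.Core using (does)
open import Relation.Nullary.Negation.Core using (¬_)
open import Relation.Unary using (Pred)

------------------------------------------------------------------------
-- Finite simple graphs.  Vertex number i ∈ {1,…,n} is the element of
-- Fin n whose value is i - 1.

record Graph (n : ℕ) : Set₁ where
  field
    Adj    : Rel (Fin n) 0ℓ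
    adj?   : Decidable Adj
    sym    : Symmetric Adj
    irrefl : Irreflexive _≡_ Adj

  neighbours : Fin n → Subset n
  neighbours i = Vec.tabulate (λ j → does (adj? i j))

  deg : Fin n → ℕ
  deg i = ∣ neighbours i ∣

module _ {n : ℕ} (G : Graph n) where
  open Graph G

  Connected : Set
  Connected = ∀ i j → Star Adj i j

  IsDominating IsIsolated : Fin n → Set
  IsDominating i = ∀ j → j <ᶠ i → Adj i j
  IsIsolated   i = ∀ j → j <ᶠ i → ¬ Adj i j

  IsThreshold : Set
  IsThreshold = ∀ i → IsDominating i ⊎ IsIsolated i

------------------------------------------------------------------------
-- The real numbers, axiomatically: an Archimedean, Cauchy complete
-- ordered field.  Classically these axioms determine ℝ up to unique
-- isomorphism.  As no order is assumed decidable, constructively built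
-- reals satisfy them too.

record RealNumbers c ℓ₁ ℓ₂ : Set (lsuc (c ⊔ ℓ₁ ⊔ ℓ₂)) where
  infix 4 _<_
  field
    heytingField : HeytingField c ℓ₁ ℓ₂

  open HeytingField heytingField public hiding (sym; zero)
    renaming (trans to ≈-trans; refl to ≈-refl)
  open HeytingField heytingField public using () renaming (sym to ≈-sym)

  commutativeRing : CommutativeRing c ℓ₁
  commutativeRing = record { isCommutativeRing = isCommutativeRing }

  open CommutativeRing commutativeRing public using (+-rawMonoid)
  open RawMonoidDefs +-rawMonoid public using (sum) renaming (_×_ to _·_)

  field
    _<_                  : Rel Carrier ℓ₂
    isStrictPartialOrder : IsStrictPartialOrder _≈_ _<_
    #⇒<⊎>                : ∀ {x y} → x # y → x < y ⊎ y < x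
    <⇒#                  : ∀ {x y} → x < y → x # y
    0<1                  : 0# < 1#
    +-monoˡ-<            : ∀ {x y} z → x < y → x + z < y + z
    *-pos                : ∀ {x y} → 0# < x → 0# < y → 0# < x * y
    archimedean          : ∀ x → ∃[ n ] x < n · 1#

  IsCauchy : (ℕ → Carrier) → Set (c ⊔ ℓ₂)
  IsCauchy s = ∀ ε → 0# < ε →
    ∃[ N ] (∀ p q → N ℕ.≤ p → N ℕ.≤ q → s p < s q + ε)

  ConvergesTo : (ℕ → Carrier) → Carrier → Set (c ⊔ ℓ₂)
  ConvergesTo s l = ∀ ε → 0# < ε →
    ∃[ N ] (∀ p → N ℕ.≤ p → s p < l + ε × l < s p + ε)

  field
    complete : ∀ s → IsCauchy s → ∃[ l ] ConvergesTo s l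

  module <-Order = IsStrictPartialOrder isStrictPartialOrder

  fromℕ : ℕ → Carrier
  fromℕ n = n · 1#

  0<fromℕ : ∀ n .{{_ : NonZero n}} → 0# < fromℕ n
  0<fromℕ (suc zero)    = <-Order.<-respʳ-≈ (≈-sym (+-identityʳ 1#)) 0<1
  0<fromℕ (suc (suc n)) = <-Order.trans (0<fromℕ (suc n))
    (<-Order.<-respˡ-≈ (+-identityˡ _) (+-monoˡ-< (fromℕ (suc n)) 0<1))

  -- Strictly, the library field yields an inverse of x - 0#, which is
  -- equal to x.
  inverse : ∀ {x} → x # 0# → Carrier
  inverse x#0 = proj₁ (#⇒invertible x#0)

  recip : ∀ n .{{_ : NonZero n}} → Carrier
  recip n = inverse (#-sym (<⇒# (0<fromℕ n)))

------------------------------------------------------------------------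

module _ {c ℓ₁ ℓ₂} (ℝ : RealNumbers c ℓ₁ ℓ₂) where
  open RealNumbers ℝ

  module LinearAlgebra where

    IsNonzero : ∀ {d} → Vector Carrier d → Set ℓ₂
    IsNonzero x = ∃[ i ] x i # 0#

    dot : ∀ {d} → Vector Carrier d → Vector Carrier d → Carrier
    dot x y = sum (λ i → x i * y i)

    Matrix : ℕ → ℕ → Set c
    Matrix m n = Fin m → Fin n → Carrier

    Eigenspace : ∀ {n} → Matrix n n → Carrier → Pred (Vector Carrier n) ℓ₁
    Eigenspace M μ f = ∀ i → dot (M i) f ≈ μ * f i

    IsEigenvalue : ∀ {n} → Matrix n n → Carrier → Set (c ⊔ ℓ₁ ⊔ ℓ₂)
    IsEigenvalue M μ = ∃[ f ] IsNonzero f × Eigenspace M μ f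

    combination : ∀ {d n} → Vector Carrier d →
                  (Fin d → Vector Carrier n) → Vector Carrier n
    combination x b v = sum (λ j → x j * b j v)

    record IsBasis {d n} (E : Pred (Vector Carrier n) ℓ₁)
                   (b : Fin d → Vector Carrier n) : Set (c ⊔ ℓ₁) where
      field
        inside      : ∀ j → E (b j)
        independent : ∀ x → (∀ v → combination x b v ≈ 0#) → ∀ j → x j ≈ 0#
        spanning    : ∀ f → E f → ∃[ x ] (∀ v → f v ≈ combination x b v)

  module PointConfiguration {d n : ℕ} (p : Fin n → Vector Carrier d) where
    open LinearAlgebra

    NotInHyperplane : Set (c ⊔ ℓ₁ ⊔ ℓ₂)
    NotInHyperplane = ∀ a z → IsNonzero a → ¬ (∀ v → dot a (p v) ≈ z)

    TakesExactlyTwoValues : Vector Carrier d → Set (c ⊔ ℓ₁ ⊔ ℓ₂)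
    TakesExactlyTwoValues a = ∃[ x ] ∃[ y ] x # y
      × (∀ v → dot a (p v) ≈ x ⊎ dot a (p v) ≈ y)
      × (∃[ v ] dot a (p v) ≈ x)
      × (∃[ v ] dot a (p v) ≈ y)

    IsTwoValued : Set (c ⊔ ℓ₁ ⊔ ℓ₂)
    IsTwoValued = NotInHyperplane × ∃[ a ] TakesExactlyTwoValues a

  module Laplacian {n : ℕ} (G : Graph n) where
    open Graph G using (deg; adj?)
    open LinearAlgebra

    laplacian : Matrix n n
    laplacian i j =
      if does (i Fin.≟ j) then fromℕ (deg i)
      else if does (adj? i j) then - 1#
      else 0#

    record Spectrum (k : ℕ) : Set (c ⊔ ℓ₁ ⊔ ℓ₂) where
      field
        eigval     : Fin (suc k) → Carrier
        eigval₀    : eigval zero ≈ 0#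
        increasing : ∀ {i j} → i <ᶠ j → eigval i < eigval j
        sound      : ∀ i → IsEigenvalue laplacian (eigval i)
        exhaustive : ∀ μ → IsEigenvalue laplacian μ → ∃[ i ] μ ≈ eigval i

      E : Fin (suc k) → Pred (Vector Carrier n) ℓ₁
      E i = Eigenspace laplacian (eigval i)

  module Design {n : ℕ} .{{_ : NonZero n}} where

    -- Weights are given on all vertices, but only those on W matter.
    Averages : Subset n → Vector Carrier n → Pred (Vector Carrier n) ℓ₁
    Averages W a f =
      recip n * sum f ≈ sum (λ w → if does (w ∈? W) then a w * f w else 0#)

    UniformWeights : Subset n → Vector Carrier n → Set (c ⊔ ℓ₁ ⊔ ℓ₂)
    UniformWeights W a = ∃[ α ] 0# < α × (∀ w → w ∈ W → a w ≈ α)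

    module _ {G : Graph n} {k : ℕ} (S : Laplacian.Spectrum G k) where
      open Laplacian.Spectrum S

      -- f ∈ E₀ ⊕ ⋯ ⊕ Eₜ: f is a sum of vectors g i ∈ E i, with
      -- g i = 0 for i > t.
      InSumUpTo : ℕ → Pred (Vector Carrier n) (c ⊔ ℓ₁)
      InSumUpTo t f = Σ[ g ∈ (Fin (suc k) → Vector Carrier n) ]
          (∀ i → toℕ i ℕ.≤ t → E i (g i))
        × (∀ i → t ℕ.< toℕ i → ∀ v → g i v ≈ 0#)
        × (∀ v → f v ≈ sum (λ i → g i v))

      IsDesign : ℕ → Subset n → Vector Carrier n → Set (c ⊔ ℓ₁)
      IsDesign t W a = ∀ f → InSumUpTo t f → Averages W a f

      IsUniformlyWeightedDesign : ℕ → Subset n → Set (c ⊔ ℓ₁ ⊔ ℓ₂)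
      IsUniformlyWeightedDesign t W =
        ∃[ a ] UniformWeights W a × IsDesign t W a

  module _ {n : ℕ} {G : Graph n} {k : ℕ} (S : Laplacian.Spectrum G k) where
    open Laplacian.Spectrum S
    open LinearAlgebra

    record Eigenconfiguration (t : ℕ) : Set (c ⊔ ℓ₁) where
      Above : Set
      Above = Σ[ i ∈ Fin (suc k) ] t ℕ.< toℕ i

      field
        dimE    : Above → ℕ
        basis   : (i : Above) → Fin (dimE i) → Vector Carrier n
        isBasis : ∀ i → IsBasis (E (proj₁ i)) (basis i)

        -- A listing, in any order, of all the chosen basis vectors; it
        -- forces β to be the sum of the dimensions dimE i.
        β       : ℕ
        rows    : Fin β ↔ Σ Above (λ i → Fin (dimE i))

      B : Matrix β n
      B r = let (i , j) = Inverse.to rows r in basis i j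

      points : Fin n → Vector Carrier β
      points v r = B r v

{-# OPTIONS --safe #-}
-- A connected threshold graph on N vertices has a dominating last vertex, so
-- row N of L f = λ f reads N f(N) - Σ f = λ f(N).  Hence Σ f = N f(N) for
-- λ = 0, while for λ ≠ 0, N one gets Σ f = 0 = f(N): the vertex N averages every
-- eigenspace except that of λ = N.  No eigenvalue exceeds N: reading the rows
-- of L f = λ f from the last vertex down to the first, each row has the form
-- C f(i) = λ f(i) with C ≤ N, so λ > N forces f = 0.  Thus λ_k = N, and the
-- eigenvector N e_N - 1 of λ_k, which takes two values, is a linear functional
-- of the eigenconfiguration.
module Submission where

open import Defs
open import Data.Nat.Base using (ℕ; suc; _≤_; _∸_)
open import Data.Fin.Base using (fromℕ)
open import Data.Fin.Subset using (⁅_⁆)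
open import Data.Product.Base using (_×_)

open import Algebra.Bundles using (CommutativeRing)
import Algebra.Properties.CommutativeSemigroup as CommutativeSemigroupProperties
import Algebra.Properties.Ring as RingProperties
import Algebra.Properties.Semiring.Sum as SemiringSum
open import Data.Bool.Base using (Bool; true; false; if_then_else_; _∨_)
open import Data.Empty using (⊥-elim)
open import Data.Fin.Base using (Fin; zero; suc; toℕ) renaming (_<_ to _<ᶠ_)
import Data.Fin.Induction as Fin
import Data.Fin.Properties as Fin
open import Data.Fin.Subset using (∣_∣)
open import Data.Fin.Subset.Properties using (_∈?_; x∈⁅x⁆; x∈⁅y⁆⇒x≡y)
open import Data.Nat.Base as ℕ using (zero; NonZero; z≤n; s≤s)
import Data.Nat.Properties as ℕ
open import Data.Product.Base using (Σ; ∃-syntax; _,_; proj₁; proj₂)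
open import Data.Sum.Base using (_⊎_; inj₁; inj₂)
import Data.Vec.Base as Vec
open import Data.Vec.Functional using (Vector)
open import Function.Base using (_∘_)
open import Function.Bundles using (module Inverse)
open import Induction.WellFounded using (Acc; acc)
open import Relation.Binary.Construct.Closure.ReflexiveTransitive using (ε; _◅_)
open import Relation.Binary.Definitions using (tri<; tri≈; tri>)
open import Relation.Binary.PropositionalEquality.Core as ≡ using (_≡_; _≢_)
open import Relation.Nullary.Decidable.Core using (Dec; does; yes; no)
open import Relation.Nullary.Decidable using (dec-true; dec-false)
open import Relation.Nullary.Negation.Core using (¬_)

-- Graphs: the last vertex of a connected threshold graph

module _ {n : ℕ} (G : Graph n) where
  open Graph G

  isDominating⇒≢⇒Adj : ∀ {i} → (∀ j → ¬ i <ᶠ j) → IsDominating G i →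
                       ∀ j → i ≢ j → Adj i j
  isDominating⇒≢⇒Adj {i} max dom j i≢j with Fin.<-cmp i j
  ... | tri< i<j _   _   = ⊥-elim (max j i<j)
  ... | tri≈ _   i≡j _   = ⊥-elim (i≢j i≡j)
  ... | tri> _   _   j<i = dom j j<i

  connected⇒neighbour : Connected G → ∀ {i j} → i ≢ j → ∃[ l ] Adj i l
  connected⇒neighbour conn {i} {j} i≢j with conn i j
  ... | ε     = ⊥-elim (i≢j ≡.refl)
  ... | a ◅ _ = _ , a

fromℕ-max : ∀ {m} (j : Fin (suc m)) → ¬ fromℕ m <ᶠ j
fromℕ-max j last<j = ℕ.<⇒≱ last<j (Fin.≤fromℕ j)

module _ {m : ℕ} (G : Graph (suc (suc m))) where
  open Graph G

  -- Every other vertex precedes the last one, so an isolated last vertex would have no neighbour at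
  -- all. Connectedness gives it one, because vertex `zero` is different from it when there are at
  -- least two vertices.
  connectedThreshold⇒lastAdj : IsThreshold G → Connected G →
    ∀ j → fromℕ (suc m) ≢ j → Adj (fromℕ (suc m)) j
  connectedThreshold⇒lastAdj thr conn with thr (fromℕ (suc m))
  ... | inj₁ dom = isDominating⇒≢⇒Adj G fromℕ-max dom
  ... | inj₂ iso with connected⇒neighbour G conn {fromℕ (suc m)} {zero} (λ ())
  ...   | l , last~l with Fin.<-cmp l (fromℕ (suc m))
  ...     | tri< l<last _ _      = ⊥-elim (iso l l<last last~l)
  ...     | tri≈ _ l≡last _      = ⊥-elim (irrefl (≡.sym l≡last) last~l)
  ...     | tri> _ _ last<l      = ⊥-elim (fromℕ-max l last<l)

module _ {c ℓ₁ ℓ₂} (ℝ : RealNumbers c ℓ₁ ℓ₂) where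
  open RealNumbers ℝ renaming (fromℕ to natural)
  open CommutativeRing commutativeRing
    using (ring; semiring)
  open RingProperties ring
    using (+-cancelʳ; //-rightDividesˡ; //-rightDividesʳ; x∙y⁻¹≈ε⇒x≈y; x≈y⇒x∙y⁻¹≈ε; [y-z]x≈yx-zx; -0#≈0#)
  open CommutativeSemigroupProperties
    (CommutativeRing.*-commutativeSemigroup commutativeRing)
    using (x∙yz≈y∙xz)
  open SemiringSum semiring
    using (sum-cong-≋; sum-replicate; sum-replicate-zero; ∑-distrib-+; ∑-comm;
           *-distribˡ-sum; *-distribʳ-sum)
  open LinearAlgebra ℝ
  open import Relation.Binary.Reasoning.Setoid setoid

  private variable
    x y z a : Carrier
    n : ℕ

  -- Ordered fields

  -- Apartness makes `x - y` invertible, and the hypothesis says `(x - y) * a` is zero. This is how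
  -- an entry satisfying two eigenvalue equations is shown to vanish.
  #⇒≈0 : x # y → x * a ≈ y * a → a ≈ 0#
  #⇒≈0 {x} {y} {a} x#y xa≈ya with #⇒invertible x#y
  ... | r , r*[x-y]≈1 , _ = begin
    a                   ≈⟨ *-identityˡ a ⟨
    1# * a              ≈⟨ *-congʳ r*[x-y]≈1 ⟨
    r * (x - y) * a     ≈⟨ *-assoc r (x - y) a ⟩
    r * ((x - y) * a)   ≈⟨ *-congˡ ([y-z]x≈yx-zx a x y) ⟩
    r * (x * a - y * a) ≈⟨ *-congˡ (x≈y⇒x∙y⁻¹≈ε xa≈ya) ⟩
    r * 0#              ≈⟨ zeroʳ r ⟩
    0#                  ∎

  +-cancelʳ-< : ∀ z → x + z < y + z → x < y
  +-cancelʳ-< {x} {y} z x+z<y+z =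
    <-Order.<-respˡ-≈ (//-rightDividesʳ z x)
      (<-Order.<-respʳ-≈ (//-rightDividesʳ z y) (+-monoˡ-< (- z) x+z<y+z))

  #-respˡ : x ≈ y → x < z → y # z
  #-respˡ x≈y x<z = <⇒# (<-Order.<-respˡ-≈ x≈y x<z)

  0<natural : Fin n → 0# < natural n
  0<natural {suc n} _ = 0<fromℕ (suc n)

  recip-inverseˡ : ∀ n .{{_ : NonZero n}} → recip n * natural n ≈ 1#
  -- `recip n` unfolds to the first component of this term, so the match turns it into `r`. What `r`
  -- inverts is `natural n - 0#`.
  recip-inverseˡ n with #⇒invertible (#-sym (<⇒# (0<fromℕ n)))
  ... | r , r*[n-0]≈1 , _ = ≈-trans
    (*-congˡ (≈-sym (≈-trans (+-congˡ -0#≈0#) (+-identityʳ (natural n))))) r*[n-0]≈1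

  -- Finite sums

  𝟙 : Bool → Carrier
  𝟙 b = if b then 1# else 0#

  δ : Fin n → Fin n → Carrier
  δ i j = 𝟙 (does (i Fin.≟ j))

  δ-≡ : (i : Fin n) → δ i i ≈ 1#
  δ-≡ i rewrite dec-true (i Fin.≟ i) ≡.refl = ≈-refl

  δ-≢ : {i j : Fin n} → i ≢ j → δ i j ≈ 0#
  δ-≢ {i = i} {j} i≢j rewrite dec-false (i Fin.≟ j) i≢j = ≈-refl

  sum-0 : {f : Vector Carrier n} → (∀ i → f i ≈ 0#) → sum f ≈ 0#
  sum-0 {n} f≈0 = ≈-trans (sum-cong-≋ f≈0) (sum-replicate-zero n)

  sum-1 : ∀ n → sum {n} (λ _ → 1#) ≈ natural n
  sum-1 n = sum-replicate n

  sum-δ : ∀ (i : Fin n) (f : Vector Carrier n) → sum (λ j → δ i j * f j) ≈ f i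
  sum-δ zero f = begin
    1# * f zero + sum (λ j → 0# * f (suc j)) ≈⟨ +-cong (*-identityˡ _) (sum-0 (λ j → zeroˡ (f (suc j)))) ⟩
    f zero + 0#                              ≈⟨ +-identityʳ _ ⟩
    f zero                                   ∎
  sum-δ (suc i) f = begin
    0# * f zero + sum (λ j → δ i j * f (suc j)) ≈⟨ +-cong (zeroˡ _) (sum-δ i (f ∘ suc)) ⟩
    0# + f (suc i)                              ≈⟨ +-identityˡ _ ⟩
    f (suc i)                                   ∎

  sum-singleton : ∀ (i : Fin n) (f : Vector Carrier n) →
                  sum (λ j → if does (j ∈? ⁅ i ⁆) then f j else 0#) ≈ f i
  sum-singleton i f = ≈-trans (sum-cong-≋ term) (sum-δ i f)
    where
    term : ∀ j → (if does (j ∈? ⁅ i ⁆) then f j else 0#) ≈ δ i j * f j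
    term j with i Fin.≟ j
    ... | yes ≡.refl rewrite dec-true (i ∈? ⁅ i ⁆) (x∈⁅x⁆ i) = ≈-sym (*-identityˡ (f i))
    ... | no i≢j rewrite dec-false (j ∈? ⁅ i ⁆) (i≢j ∘ ≡.sym ∘ x∈⁅y⁆⇒x≡y i) = ≈-sym (zeroˡ (f j))

  sum-𝟙 : (b : Fin n → Bool) → natural ∣ Vec.tabulate b ∣ ≈ sum (𝟙 ∘ b)
  sum-𝟙 {zero}  b = ≈-refl
  sum-𝟙 {suc n} b with b zero
  ... | true  = +-congˡ (sum-𝟙 (b ∘ suc))
  ... | false = ≈-trans (sum-𝟙 (b ∘ suc)) (≈-sym (+-identityˡ _))

  -- At most `n` terms equal 1. The bound is phrased through every `z` above `n` since the order is
  -- given by `<` alone; in the induction each `true` lowers `z` by 1.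
  sum-𝟙-< : ∀ (b : Fin n → Bool) → natural n < z → sum (𝟙 ∘ b) < z
  sum-𝟙-< {zero}      b 0<z = 0<z
  sum-𝟙-< {suc n} {z} b 1+n<z with b zero
  ... | true  = <-Order.<-respʳ-≈ z-1+1≈z (<-Order.<-respˡ-≈ (+-comm _ 1#)
    (+-monoˡ-< 1# (sum-𝟙-< (b ∘ suc) n<z-1)))
    where
    z-1+1≈z : z - 1# + 1# ≈ z
    z-1+1≈z = //-rightDividesˡ 1# z

    n<z-1 : natural n < z - 1#
    n<z-1 = +-cancelʳ-< 1# (<-Order.<-respˡ-≈ (+-comm 1# _) (<-Order.<-respʳ-≈ (≈-sym z-1+1≈z) 1+n<z))
  ... | false = <-Order.<-respˡ-≈ (≈-sym (+-identityˡ _))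
    (sum-𝟙-< (b ∘ suc) (<-Order.trans
      (<-Order.<-respˡ-≈ (+-identityˡ _) (+-monoˡ-< (natural n) 0<1)) 1+n<z))

  -- Eigenspaces

  dot-0ʳ : (w : Vector Carrier n) {f : Vector Carrier n} → (∀ v → f v ≈ 0#) → dot w f ≈ 0#
  dot-0ʳ w f≈0 = sum-0 (λ v → ≈-trans (*-congˡ (f≈0 v)) (zeroʳ (w v)))

  dot-*ʳ : (w : Vector Carrier n) (x : Carrier) (f : Vector Carrier n) →
           dot w (λ v → x * f v) ≈ x * dot w f
  dot-*ʳ w x f = begin
    sum (λ v → w v * (x * f v)) ≈⟨ sum-cong-≋ (λ v → x∙yz≈y∙xz (w v) x (f v)) ⟩
    sum (λ v → x * (w v * f v)) ≈⟨ *-distribˡ-sum x (λ v → w v * f v) ⟨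
    x * dot w f                 ∎

  dot-sumʳ : ∀ {d} (w : Vector Carrier n) (g : Fin d → Vector Carrier n) →
             dot w (λ v → sum (λ i → g i v)) ≈ sum (λ i → dot w (g i))
  dot-sumʳ w g = begin
    sum (λ v → w v * sum (λ i → g i v))   ≈⟨ sum-cong-≋ (λ v → *-distribˡ-sum (w v) (λ i → g i v)) ⟩
    sum (λ v → sum (λ i → w v * g i v))   ≈⟨ ∑-comm (λ v i → w v * g i v) ⟩
    sum (λ i → dot w (g i))               ∎

  module _ {n : ℕ} (M : Matrix n n) where

    eigenspace-0 : {f : Vector Carrier n} → (∀ v → f v ≈ 0#) → Eigenspace M x f
    eigenspace-0 {x} f≈0 i = ≈-trans (dot-0ʳ (M i) f≈0)
      (≈-sym (≈-trans (*-congˡ (f≈0 i)) (zeroʳ x)))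

    eigenspace-* : ∀ y {f} → Eigenspace M x f → Eigenspace M x (λ v → y * f v)
    eigenspace-* {x} y {f} Ef i = begin
      dot (M i) (λ v → y * f v) ≈⟨ dot-*ʳ (M i) y f ⟩
      y * dot (M i) f           ≈⟨ *-congˡ (Ef i) ⟩
      y * (x * f i)             ≈⟨ x∙yz≈y∙xz y x (f i) ⟩
      x * (y * f i)             ∎

    eigenspace-sum : ∀ {d} {g : Fin d → Vector Carrier n} → (∀ r → Eigenspace M x (g r)) →
                     Eigenspace M x (λ v → sum (λ r → g r v))
    eigenspace-sum {x} {g = g} Eg i = begin
      dot (M i) (λ v → sum (λ r → g r v)) ≈⟨ dot-sumʳ (M i) g ⟩
      sum (λ r → dot (M i) (g r))         ≈⟨ sum-cong-≋ (λ r → Eg r i) ⟩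
      sum (λ r → x * g r i)               ≈⟨ *-distribˡ-sum x (λ r → g r i) ⟨
      x * sum (λ r → g r i)               ∎

    -- Induction on `d`: applying `M - μ₀` to the vanishing sum leaves a vanishing sum with one
    -- eigenspace fewer. The factors `μ (suc i) - μ₀` can be cancelled because the eigenvalues are
    -- apart.
    eigenspaces-independent : ∀ {d} (μ : Fin d → Carrier) (g : Fin d → Vector Carrier n) →
      (∀ {i j} → i <ᶠ j → μ i # μ j) → (∀ i → Eigenspace M (μ i) (g i)) →
      (∀ v → sum (λ i → g i v) ≈ 0#) → ∀ i v → g i v ≈ 0#
    eigenspaces-independent {suc d} μ g distinct Eg ∑g≈0 = all
      where
      μ₀ = μ zero

      -- M - μ₀ kills g zero and multiplies g (suc i) by μ (suc i) - μ₀.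
      g′ : Fin d → Vector Carrier n
      g′ i v = (μ (suc i) - μ₀) * g (suc i) v

      weighted : ∀ v → sum (λ i → μ i * g i v) ≈ 0#
      weighted v = begin
        sum (λ i → μ i * g i v)             ≈⟨ sum-cong-≋ (λ i → Eg i v) ⟨
        sum (λ i → dot (M v) (g i))         ≈⟨ dot-sumʳ (M v) g ⟨
        dot (M v) (λ w → sum (λ i → g i w)) ≈⟨ dot-0ʳ (M v) ∑g≈0 ⟩
        0#                                  ∎

      split : ∀ v i → (μ i - μ₀) * g i v + μ₀ * g i v ≈ μ i * g i v
      split v i = begin
        (μ i - μ₀) * g i v + μ₀ * g i v ≈⟨ distribʳ (g i v) _ _ ⟨
        (μ i - μ₀ + μ₀) * g i v         ≈⟨ *-congʳ (//-rightDividesˡ μ₀ (μ i)) ⟩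
        μ i * g i v                     ∎

      ∑g′≈0 : ∀ v → sum (λ i → g′ i v) ≈ 0#
      ∑g′≈0 v = begin
        sum (λ i → g′ i v)                     ≈⟨ +-identityˡ _ ⟨
        -- The missing term at index `zero` has factor `μ₀ - μ₀`, so it can be put back and the sum
        -- taken over all indices.
        0# + sum (λ i → g′ i v)                ≈⟨ +-congʳ (≈-trans (*-congʳ (-‿inverseʳ μ₀)) (zeroˡ _)) ⟨
        sum (λ i → (μ i - μ₀) * g i v)         ≈⟨ +-identityʳ _ ⟨
        sum (λ i → (μ i - μ₀) * g i v) + 0#    ≈⟨ +-congˡ (≈-trans (*-congˡ (∑g≈0 v)) (zeroʳ μ₀)) ⟨
        sum (λ i → (μ i - μ₀) * g i v) + μ₀ * sum (λ i → g i v)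
                                               ≈⟨ +-congˡ (*-distribˡ-sum μ₀ (λ i → g i v)) ⟩
        sum (λ i → (μ i - μ₀) * g i v) + sum (λ i → μ₀ * g i v)
                                               ≈⟨ ∑-distrib-+ (λ i → (μ i - μ₀) * g i v) (λ i → μ₀ * g i v) ⟨
        sum (λ i → (μ i - μ₀) * g i v + μ₀ * g i v)
                                               ≈⟨ sum-cong-≋ (split v) ⟩
        sum (λ i → μ i * g i v)                ≈⟨ weighted v ⟩
        0#                                     ∎

      g′≈0 : ∀ i v → g′ i v ≈ 0#
      g′≈0 = eigenspaces-independent (μ ∘ suc) g′ (distinct ∘ s≤s)
        (λ i → eigenspace-* _ (Eg (suc i))) ∑g′≈0

      later : ∀ i v → g (suc i) v ≈ 0#
      later i v = #⇒≈0 (#-sym (distinct (s≤s z≤n)))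
        (x∙y⁻¹≈ε⇒x≈y _ _ (≈-trans (≈-sym ([y-z]x≈yx-zx _ _ _)) (g′≈0 i v)))

      all : ∀ i v → g i v ≈ 0#
      all (suc i) v = later i v
      all zero    v = begin
        g zero v                                ≈⟨ +-identityʳ _ ⟨
        g zero v + 0#                           ≈⟨ +-congˡ (sum-0 (λ i → later i v)) ⟨
        g zero v + sum (λ i → g (suc i) v)      ≈⟨ ∑g≈0 v ⟩
        0#                                      ∎

  -- Laplacians

  module _ {n : ℕ} (G : Graph n) where
    open Graph G using (Adj; adj?; deg; irrefl) renaming (sym to Adj-sym)
    open Laplacian ℝ G

    A : Matrix n n
    A i j = 𝟙 (does (adj? i j))

    A-Adj : ∀ {i j} → Adj i j → A i j ≈ 1#
    A-Adj {i} {j} i~j rewrite dec-true (adj? i j) i~j = ≈-refl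

    A-¬Adj : ∀ {i j} → ¬ Adj i j → A i j ≈ 0#
    A-¬Adj {i} {j} i≁j rewrite dec-false (adj? i j) i≁j = ≈-refl

    A-sym : ∀ i j → A i j ≈ A j i
    A-sym i j with adj? i j
    ... | yes i~j = ≈-sym (A-Adj (Adj-sym i~j))
    ... | no  i≁j = ≈-sym (A-¬Adj (i≁j ∘ Adj-sym))

    A-diag : ∀ i → A i i ≈ 0#
    A-diag i = A-¬Adj (irrefl ≡.refl)

    -- Laplacian plus adjacency matrix is the diagonal degree matrix; the degree is written as a row
    -- sum of `A`.
    laplacian-row : ∀ i f → dot (laplacian i) f + dot (A i) f ≈ sum (A i) * f i
    laplacian-row i f = begin
      dot (laplacian i) f + dot (A i) f               ≈⟨ ∑-distrib-+ (λ j → laplacian i j * f j) _ ⟨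
      sum (λ j → laplacian i j * f j + A i j * f j)   ≈⟨ sum-cong-≋ term ⟩
      sum (λ j → δ i j * (natural (deg i) * f j))     ≈⟨ sum-δ i _ ⟩
      natural (deg i) * f i                           ≈⟨ *-congʳ (sum-𝟙 (λ j → does (adj? i j))) ⟩
      sum (A i) * f i                                 ∎
      where
      term : ∀ j → laplacian i j * f j + A i j * f j ≈ δ i j * (natural (deg i) * f j)
      term j with i Fin.≟ j
      ... | yes ≡.refl = begin
        natural (deg i) * f i + A i i * f i ≈⟨ +-congˡ (≈-trans (*-congʳ (A-diag i)) (zeroˡ _)) ⟩
        natural (deg i) * f i + 0#          ≈⟨ +-identityʳ _ ⟩
        natural (deg i) * f i               ≈⟨ *-identityˡ _ ⟨
        1# * (natural (deg i) * f i)        ∎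
      ... | no _ with does (adj? i j)
      ...   | true = begin
        - 1# * f j + 1# * f j         ≈⟨ distribʳ (f j) _ _ ⟨
        (- 1# + 1#) * f j             ≈⟨ *-congʳ (-‿inverseˡ 1#) ⟩
        0# * f j                      ≈⟨ zeroˡ _ ⟩
        0#                            ≈⟨ zeroˡ _ ⟨
        0# * (natural (deg i) * f j)  ∎
      ...   | false = begin
        0# * f j + 0# * f j           ≈⟨ +-cong (zeroˡ _) (zeroˡ _) ⟩
        0# + 0#                       ≈⟨ +-identityʳ _ ⟩
        0#                            ≈⟨ zeroˡ _ ⟨
        0# * (natural (deg i) * f j)  ∎

    -- The columns of the Laplacian sum to zero: by symmetry of `A`, its row sums, which are the
    -- degrees, are also its column sums.
    sum-laplacian : ∀ f → sum (λ i → dot (laplacian i) f) ≈ 0#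
    sum-laplacian f = +-cancelʳ (sum (λ i → dot (A i) f)) _ _ (begin
      sum (λ i → dot (laplacian i) f) + sum (λ i → dot (A i) f)
        ≈⟨ ∑-distrib-+ (λ i → dot (laplacian i) f) _ ⟨
      sum (λ i → dot (laplacian i) f + dot (A i) f)
        ≈⟨ sum-cong-≋ (λ i → laplacian-row i f) ⟩
      sum (λ i → sum (A i) * f i)
        ≈⟨ sum-cong-≋ (λ i → *-distribʳ-sum (f i) (A i)) ⟩
      sum (λ i → sum (λ j → A i j * f i))
        ≈⟨ ∑-comm (λ i j → A i j * f i) ⟩
      sum (λ j → sum (λ i → A i j * f i))
        ≈⟨ sum-cong-≋ (λ j → sum-cong-≋ (λ i → *-congʳ (A-sym i j))) ⟩
      sum (λ j → dot (A j) f)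
        ≈⟨ +-identityˡ _ ⟨
      0# + sum (λ i → dot (A i) f) ∎)

    eigenvector-sum : ∀ {f} → x # 0# → Eigenspace laplacian x f → sum f ≈ 0#
    eigenvector-sum {x} {f} x#0 Ef = #⇒≈0 x#0 (begin
      x * sum f                        ≈⟨ *-distribˡ-sum x f ⟩
      sum (λ i → x * f i)              ≈⟨ sum-cong-≋ Ef ⟨
      sum (λ i → dot (laplacian i) f)  ≈⟨ sum-laplacian f ⟩
      0#                               ≈⟨ zeroˡ _ ⟨
      0# * sum f                       ∎)

    -- Row `i` of `A` is 1 everywhere except on the diagonal, so adding `δ i` makes it constant.
    -- This is applied twice, to `f` and to the constant vector `f i`.
    laplacian-row-dominating : ∀ {i} → (∀ j → i ≢ j → Adj i j) → ∀ f →
      dot (laplacian i) f + sum f ≈ natural n * f i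
    laplacian-row-dominating {i} i~ f = begin
      dot (laplacian i) f + sum f                   ≈⟨ +-congˡ (A+δ f) ⟨
      dot (laplacian i) f + (dot (A i) f + f i)     ≈⟨ +-assoc _ _ _ ⟨
      dot (laplacian i) f + dot (A i) f + f i       ≈⟨ +-congʳ (laplacian-row i f) ⟩
      sum (A i) * f i + f i                         ≈⟨ +-congʳ (*-distribʳ-sum (f i) (A i)) ⟩
      dot (A i) (λ _ → f i) + f i                   ≈⟨ A+δ (λ _ → f i) ⟩
      sum {n} (λ _ → f i)                           ≈⟨ sum-cong-≋ {n} (λ _ → *-identityˡ (f i)) ⟨
      sum {n} (λ _ → 1# * f i)                      ≈⟨ *-distribʳ-sum {n} (f i) (λ _ → 1#) ⟨
      sum {n} (λ _ → 1#) * f i                      ≈⟨ *-congʳ (sum-1 n) ⟩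
      natural n * f i                               ∎
      where
      A+δ≈1 : ∀ j → A i j + δ i j ≈ 1#
      A+δ≈1 j with i Fin.≟ j
      ... | yes ≡.refl = ≈-trans (+-congʳ (A-diag i)) (+-identityˡ 1#)
      ... | no i≢j     = ≈-trans (+-congʳ (A-Adj (i~ j i≢j))) (+-identityʳ 1#)

      A+δ : ∀ g → dot (A i) g + g i ≈ sum g
      A+δ g = begin
        dot (A i) g + g i                         ≈⟨ +-congˡ (sum-δ i g) ⟨
        dot (A i) g + sum (λ j → δ i j * g j)     ≈⟨ ∑-distrib-+ (λ j → A i j * g j) _ ⟨
        sum (λ j → A i j * g j + δ i j * g j)     ≈⟨ sum-cong-≋ (λ j → distribʳ (g j) _ _) ⟨
        sum (λ j → (A i j + δ i j) * g j)         ≈⟨ sum-cong-≋ (λ j → *-congʳ (A+δ≈1 j)) ⟩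
        sum (λ j → 1# * g j)                      ≈⟨ sum-cong-≋ (λ j → *-identityˡ (g j)) ⟩
        sum g                                     ∎

    -- Threshold graphs: no Laplacian eigenvalue exceeds n

    module _ (threshold : IsThreshold G) {f : Vector Carrier n} (∑f≈0 : sum f ≈ 0#) where

      -- If `i` is isolated, its neighbours all come later, where `f` vanishes, and the coefficient
      -- is the degree. If `i` is dominating, its neighbours contribute the sum of `f` before `i`,
      -- which is `- f i` because `f` has sum zero, and the coefficient is the degree plus one.
      -- Giving it as a count of `b` over the vertices bounds it by `n`.
      laplacian-row-threshold : ∀ i → (∀ j → i <ᶠ j → f j ≈ 0#) →
        ∃[ b ] dot (laplacian i) f ≈ sum {n} (𝟙 ∘ b) * f i
      laplacian-row-threshold i f>i≈0 with threshold i
      ... | inj₂ iso = (λ j → does (adj? i j)) , (begin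
        dot (laplacian i) f                   ≈⟨ +-identityʳ _ ⟨
        dot (laplacian i) f + 0#              ≈⟨ +-congˡ (sum-0 A*f≈0) ⟨
        dot (laplacian i) f + dot (A i) f     ≈⟨ laplacian-row i f ⟩
        sum (A i) * f i                       ∎)
        where
        A*f≈0 : ∀ j → A i j * f j ≈ 0#
        A*f≈0 j with Fin.<-cmp i j
        ... | tri< i<j _ _    = ≈-trans (*-congˡ (f>i≈0 j i<j)) (zeroʳ _)
        ... | tri≈ _ ≡.refl _ = ≈-trans (*-congʳ (A-diag i)) (zeroˡ _)
        ... | tri> _ _ j<i    = ≈-trans (*-congʳ (A-¬Adj (iso j j<i))) (zeroˡ _)
      ... | inj₁ dom = b , +-cancelʳ (dot (A i) f) _ _ (begin
        dot (laplacian i) f + dot (A i) f             ≈⟨ laplacian-row i f ⟩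
        sum (A i) * f i                               ≈⟨ *-distribʳ-sum (f i) (A i) ⟩
        sum (λ j → A i j * f i)                       ≈⟨ +-identityʳ _ ⟨
        sum (λ j → A i j * f i) + 0#                  ≈⟨ +-congˡ ∑f≈0 ⟨
        sum (λ j → A i j * f i) + sum f               ≈⟨ ∑-distrib-+ (λ j → A i j * f i) f ⟨
        sum (λ j → A i j * f i + f j)                 ≈⟨ sum-cong-≋ term ⟩
        sum (λ j → 𝟙 (b j) * f i + A i j * f j)       ≈⟨ ∑-distrib-+ (λ j → 𝟙 (b j) * f i) _ ⟩
        sum (λ j → 𝟙 (b j) * f i) + dot (A i) f       ≈⟨ +-congʳ (*-distribʳ-sum (f i) (𝟙 ∘ b)) ⟨
        sum (𝟙 ∘ b) * f i + dot (A i) f               ∎)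
        where
        -- The neighbours of `i` together with `i` itself: a dominating `i` is adjacent to
        -- everything before it.
        b : Fin n → Bool
        b j = does (j Fin.≤? i) ∨ does (adj? i j)

        b-≤ : ∀ {j} → toℕ j ≤ toℕ i → 𝟙 (b j) ≈ 1#
        b-≤ {j} j≤i rewrite dec-true (j Fin.≤? i) j≤i = ≈-refl

        b-> : ∀ {j} → i <ᶠ j → 𝟙 (b j) ≈ A i j
        b-> {j} i<j rewrite dec-false (j Fin.≤? i) (ℕ.<⇒≱ i<j) = ≈-refl

        term : ∀ j → A i j * f i + f j ≈ 𝟙 (b j) * f i + A i j * f j
        term j with Fin.<-cmp i j
        ... | tri< i<j _ _ = +-cong (*-congʳ (≈-sym (b-> i<j)))
          (≈-trans (f>i≈0 j i<j) (≈-sym (≈-trans (*-congˡ (f>i≈0 j i<j)) (zeroʳ _))))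
        ... | tri≈ _ ≡.refl _ = ≈-trans (+-comm _ _)
          (+-congʳ (≈-sym (≈-trans (*-congʳ (b-≤ {i} ℕ.≤-refl)) (*-identityˡ _))))
        ... | tri> _ _ j<i = +-cong
          (*-congʳ (≈-trans (A-Adj (dom j j<i)) (≈-sym (b-≤ (ℕ.<⇒≤ j<i)))))
          (≈-sym (≈-trans (*-congʳ (A-Adj (dom j j<i))) (*-identityˡ _)))

      -- Descending induction on `i`: row `i` equates `x * f i` with a multiple of `f i` by a count
      -- at most `n`, hence apart from `x`.
      eigenvector-≈0 : natural n < x → Eigenspace laplacian x f → ∀ i → f i ≈ 0#
      eigenvector-≈0 {x} n<x Ef i = go i (Fin.>-wellFounded i)
        where
        go : ∀ i → Acc (λ j l → l <ᶠ j) i → f i ≈ 0#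
        go i (acc rs) with laplacian-row-threshold i (λ j i<j → go j (rs i<j))
        ... | b , Lf≈ = #⇒≈0 (<⇒# (sum-𝟙-< b n<x)) (≈-trans (≈-sym Lf≈) (Ef i))

    natural≮eigenvalue : IsThreshold G → IsEigenvalue laplacian x → ¬ natural n < x
    natural≮eigenvalue {x} threshold (f , (i , fi#0) , Ef) n<x =
      #-irrefl (eigenvector-≈0 threshold ∑f≈0 n<x Ef i) fi#0
      where
      ∑f≈0 : sum f ≈ 0#
      -- The existence of the vertex `i` makes `natural n` positive, and with it `x`.
      ∑f≈0 = eigenvector-sum (#-sym (<⇒# (<-Order.trans (0<natural i) n<x))) Ef

    -- Eigenvectors and a vertex adjacent to all others

    module _ {u : Fin n} (u~ : ∀ j → u ≢ j → Adj u j) where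

      -- Row `u` reads `x * f u + sum f ≈ natural n * f u`. The case distinction on `x` is a
      -- hypothesis because equality of reals is not assumed decidable; the ordering of the spectrum
      -- supplies it later.
      eigenvector-average : ∀ {f} → x ≈ 0# ⊎ (x # 0# × x # natural n) →
        Eigenspace laplacian x f → sum f ≈ natural n * f u
      eigenvector-average {x} {f} (inj₁ x≈0) Ef = begin
        sum f                        ≈⟨ +-identityˡ _ ⟨
        0# + sum f                   ≈⟨ +-congʳ (≈-trans (*-congʳ x≈0) (zeroˡ (f u))) ⟨
        x * f u + sum f              ≈⟨ +-congʳ (Ef u) ⟨
        dot (laplacian u) f + sum f  ≈⟨ laplacian-row-dominating u~ f ⟩
        natural n * f u              ∎
      eigenvector-average {x} {f} (inj₂ (x#0 , x#n)) Ef =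
        ≈-trans ∑f≈0 (≈-sym (≈-trans (*-congˡ fu≈0) (zeroʳ _)))
        where
        ∑f≈0 : sum f ≈ 0#
        ∑f≈0 = eigenvector-sum x#0 Ef

        fu≈0 : f u ≈ 0#
        fu≈0 = #⇒≈0 x#n (begin
          x * f u                      ≈⟨ Ef u ⟨
          dot (laplacian u) f          ≈⟨ +-identityʳ _ ⟨
          dot (laplacian u) f + 0#     ≈⟨ +-congˡ ∑f≈0 ⟨
          dot (laplacian u) f + sum f  ≈⟨ laplacian-row-dominating u~ f ⟩
          natural n * f u              ∎)

      -- This is `n` times the projection of the unit vector at `u` onto the vectors of sum zero.
      -- Its values are mostly handled through `peak i + 1#`, which avoids subtraction.
      peak : Vector Carrier n
      peak i = natural n * δ u i - 1#

      peak+1 : ∀ i → peak i + 1# ≈ natural n * δ u i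
      peak+1 i = //-rightDividesˡ 1# (natural n * δ u i)

      peak-≡ : peak u + 1# ≈ natural n
      peak-≡ = ≈-trans (peak+1 u) (≈-trans (*-congˡ (δ-≡ u)) (*-identityʳ _))

      peak-≢ : ∀ {i} → u ≢ i → peak i + 1# ≈ 0#
      peak-≢ {i} u≢i = ≈-trans (peak+1 i) (≈-trans (*-congˡ (δ-≢ u≢i)) (zeroʳ _))

      sum-peak : sum peak ≈ 0#
      sum-peak = +-cancelʳ (natural n) _ _ (begin
        sum peak + natural n                 ≈⟨ +-congˡ (sum-1 n) ⟨
        sum peak + sum {n} (λ _ → 1#)        ≈⟨ ∑-distrib-+ peak (λ _ → 1#) ⟨
        sum (λ i → peak i + 1#)              ≈⟨ sum-cong-≋ (λ i → ≈-trans (peak+1 i) (*-comm _ _)) ⟩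
        sum (λ i → δ u i * natural n)        ≈⟨ sum-δ u (λ _ → natural n) ⟩
        natural n                            ≈⟨ +-identityˡ _ ⟨
        0# + natural n                       ∎)

      -- At `u` the row of a dominating vertex applies, with sum zero. Elsewhere constants are
      -- killed by the Laplacian, so only the entry `-1` of the edge to `u` counts: it gives `-n`,
      -- and `peak` is `-1` there.
      peak-eigenvector : Eigenspace laplacian (natural n) peak
      peak-eigenvector i with u Fin.≟ i
      ... | yes ≡.refl = begin
        dot (laplacian u) peak             ≈⟨ +-identityʳ _ ⟨
        dot (laplacian u) peak + 0#        ≈⟨ +-congˡ sum-peak ⟨
        dot (laplacian u) peak + sum peak  ≈⟨ laplacian-row-dominating u~ peak ⟩
        -- The match has reduced `δ` in the goal to `1#`, and in the next case to `0#`, so `peak`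
        -- has to be rewritten accordingly.
        natural n * peak u                 ≈⟨ *-congˡ (+-congʳ (*-congˡ (δ-≡ u))) ⟩
        natural n * (natural n * 1# - 1#)  ∎
      ... | no u≢i = +-cancelʳ (natural n) _ _ (begin
        dot (laplacian i) peak + natural n  ≈⟨ row ⟩
        0#                                  ≈⟨ zeroʳ _ ⟨
        natural n * 0#                      ≈⟨ *-congˡ (≈-trans (+-congʳ (+-congʳ (*-congˡ (≈-sym (δ-≢ u≢i))))) (peak-≢ u≢i)) ⟨
        natural n * (natural n * 0# - 1# + 1#)
                                            ≈⟨ distribˡ _ _ 1# ⟩
        natural n * (natural n * 0# - 1#) + natural n * 1#
                                            ≈⟨ +-congˡ (*-identityʳ _) ⟩
        natural n * (natural n * 0# - 1#) + natural n ∎)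
        where
        -- Both sides of laplacian-row are augmented by Σ A i j, which turns
        -- peak into peak + 1 = n δ u.
        A*[peak+1] : dot (A i) (λ j → peak j + 1#) ≈ natural n
        A*[peak+1] = begin
          sum (λ j → A i j * (peak j + 1#))       ≈⟨ sum-cong-≋ (λ j → *-congˡ (≈-trans (peak+1 j) (*-comm _ _))) ⟩
          sum (λ j → A i j * (δ u j * natural n)) ≈⟨ sum-cong-≋ (λ j → x∙yz≈y∙xz (A i j) (δ u j) _) ⟩
          sum (λ j → δ u j * (A i j * natural n)) ≈⟨ sum-δ u (λ j → A i j * natural n) ⟩
          A i u * natural n                       ≈⟨ *-congʳ (A-Adj (Adj-sym (u~ i u≢i))) ⟩
          1# * natural n                          ≈⟨ *-identityˡ _ ⟩
          natural n                               ∎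

        row : dot (laplacian i) peak + natural n ≈ 0#
        row = begin
          dot (laplacian i) peak + natural n
            ≈⟨ +-congˡ A*[peak+1] ⟨
          dot (laplacian i) peak + sum (λ j → A i j * (peak j + 1#))
            ≈⟨ +-congˡ (sum-cong-≋ (λ j → distribˡ (A i j) (peak j) 1#)) ⟩
          dot (laplacian i) peak + sum (λ j → A i j * peak j + A i j * 1#)
            ≈⟨ +-congˡ (∑-distrib-+ (λ j → A i j * peak j) (λ j → A i j * 1#)) ⟩
          dot (laplacian i) peak + (dot (A i) peak + sum (λ j → A i j * 1#))
            ≈⟨ +-assoc _ _ _ ⟨
          dot (laplacian i) peak + dot (A i) peak + sum (λ j → A i j * 1#)
            ≈⟨ +-cong (laplacian-row i peak) (≈-sym (*-distribʳ-sum 1# (A i))) ⟩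
          sum (A i) * peak i + sum (A i) * 1#
            ≈⟨ distribˡ _ _ _ ⟨
          sum (A i) * (peak i + 1#)
            ≈⟨ *-congˡ (peak-≢ u≢i) ⟩
          sum (A i) * 0#
            ≈⟨ zeroʳ _ ⟩
          0# ∎

      peak-# : ∀ {i} → u ≢ i → peak i # peak u
      peak-# u≢i = <⇒# (+-cancelʳ-< 1# (<-Order.<-respˡ-≈ (≈-sym (peak-≢ u≢i))
        (<-Order.<-respʳ-≈ (≈-sym peak-≡) (0<natural u))))

      natural-eigenvalue : ∀ {i} → u ≢ i → IsEigenvalue laplacian (natural n)
      natural-eigenvalue {i} u≢i = peak , nonzero , peak-eigenvector
        where
        nonzero : IsNonzero peak
        -- Of two entries apart from each other, cotransitivity yields one apart from zero.
        nonzero with #-cotrans (peak-# u≢i) 0#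
        ... | inj₁ peakᵢ#0 = i , peakᵢ#0
        ... | inj₂ 0#peakᵤ = u , #-sym 0#peakᵤ

  -- Eigenconfigurations

  module _ {G : Graph n} {k : ℕ} (S : Laplacian.Spectrum ℝ G k) where
    open Laplacian ℝ G
    open Spectrum S

    eigval-#0 : ∀ {i} → 1 ≤ toℕ i → eigval i # 0#
    eigval-#0 1≤i = #-sym (#-respˡ eigval₀ (increasing 1≤i))

    module _ {t : ℕ} (𝓑 : Eigenconfiguration ℝ S t) where
      open Eigenconfiguration 𝓑
      open Inverse rows using (to; from; strictlyInverseˡ; strictlyInverseʳ)

      index : Fin β → Fin (suc k)
      index r = proj₁ (proj₁ (to r))

      B-eigenvector : ∀ r → E (index r) (B r)
      B-eigenvector r = let (i , j) = to r in IsBasis.inside (isBasis i) j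

      B-from : ∀ i j v → B (from (i , j)) v ≈ basis i j v
      B-from i j v rewrite strictlyInverseˡ (i , j) = ≈-refl

      from≡⇒ : ∀ {p q r} → to r ≡ q → from p ≡ r → p ≡ q
      from≡⇒ to-r ≡.refl = ≡.trans (≡.sym (strictlyInverseˡ _)) to-r

      -- Row `r` stands for exactly one basis vector, so it is hit once by the basis of its own
      -- eigenspace and never by another. Sums over one basis thereby become sums over all rows with
      -- a cut-off `δ`.
      fibre-count : ∀ (i : Above) r →
        sum (λ j → δ (from (i , j)) r) ≈ δ (index r) (proj₁ i)
      fibre-count i r with to r in to-r
      ... | i′ , j′ with proj₁ i′ Fin.≟ proj₁ i
      ...   | no i′≢i = sum-0 {f = λ j → δ (from (i , j)) r} (λ j → δ-≢ (λ from≡r →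
                i′≢i (≡.sym (≡.cong (proj₁ ∘ proj₁) (from≡⇒ to-r from≡r)))))
      fibre-count (i , t<i) r | (.i , t<i′) , j′ | yes ≡.refl
        -- An element of `Above` carries a proof of `t < i`; irrelevance of that proof makes equal
        -- indices equal elements.
        with ℕ.≤-irrelevant t<i t<i′
      ... | ≡.refl = begin
        sum (λ j → δ (from ((i , t<i) , j)) r)  ≈⟨ sum-cong-≋ term ⟩
        sum (λ j → δ j′ j * 1#)                 ≈⟨ sum-δ j′ (λ _ → 1#) ⟩
        1#                                      ∎
        where
        from-j′ : from ((i , t<i) , j′) ≡ r
        from-j′ = ≡.trans (≡.cong from (≡.sym to-r)) (strictlyInverseʳ r)

        term : ∀ j → δ (from ((i , t<i) , j)) r ≈ δ j′ j * 1#
        term j with j′ Fin.≟ j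
        ... | yes ≡.refl rewrite from-j′ = ≈-trans (δ-≡ r) (≈-sym (*-identityˡ 1#))
        ... | no j′≢j = ≈-trans
          (δ-≢ {i = from ((i , t<i) , j)} (λ from≡r → j′≢j (second (≡.sym (from≡⇒ to-r from≡r)))))
          (≈-sym (zeroˡ 1#))
          where
          second : ∀ {j j′ : Fin (dimE (i , t<i))} →
                   _≡_ {A = Σ Above (Fin ∘ dimE)} ((i , t<i) , j) ((i , t<i) , j′) → j ≡ j′
          second ≡.refl = ≡.refl

      sum-fibre : ∀ (i : Above) (f : Vector Carrier β) →
        sum (λ j → f (from (i , j))) ≈ sum (λ r → δ (index r) (proj₁ i) * f r)
      sum-fibre i f = begin
        sum (λ j → f (from (i , j)))
          ≈⟨ sum-cong-≋ (λ j → sum-δ (from (i , j)) f) ⟨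
        sum (λ j → sum (λ r → δ (from (i , j)) r * f r))
          ≈⟨ ∑-comm (λ j r → δ (from (i , j)) r * f r) ⟩
        sum (λ r → sum (λ j → δ (from (i , j)) r * f r))
          ≈⟨ sum-cong-≋ (λ r → *-distribʳ-sum (f r) (λ j → δ (from (i , j)) r)) ⟨
        sum (λ r → sum (λ j → δ (from (i , j)) r) * f r)
          ≈⟨ sum-cong-≋ (λ r → *-congʳ (fibre-count i r)) ⟩
        sum (λ r → δ (index r) (proj₁ i) * f r) ∎

      -- The combination of rows is grouped by eigenspace. Independence of eigenspaces makes each
      -- group vanish, and independence of each basis then makes its coefficients vanish.
      rows-independent : ∀ a → (∀ v → dot a (points v) ≈ 0#) → ∀ r → a r ≈ 0#
      rows-independent a aB≈0 r = ≡.subst (λ r → a r ≈ 0#) (strictlyInverseʳ r)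
        (let (i , j) = to r in coefficients≈0 i j)
        where
        -- Defined for every eigenvalue, so that the whole spectrum can be used at once; up to `t`
        -- no row matches and the component is zero.
        component : Fin (suc k) → Vector Carrier n
        component i v = sum (λ r → δ (index r) i * (a r * B r v))

        component∈E : ∀ i → E i (component i)
        component∈E i = eigenspace-sum laplacian summand∈E
          where
          summand∈E : ∀ r → E i (λ v → δ (index r) i * (a r * B r v))
          summand∈E r with index r Fin.≟ i
          ... | yes ≡.refl = eigenspace-* laplacian 1# (eigenspace-* laplacian (a r) (B-eigenvector r))
          ... | no _ = eigenspace-0 laplacian (λ v → zeroˡ _)

        ∑component≈0 : ∀ v → sum (λ i → component i v) ≈ 0#
        ∑component≈0 v = begin
          sum (λ i → sum (λ r → δ (index r) i * (a r * B r v)))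
            ≈⟨ ∑-comm (λ i r → δ (index r) i * (a r * B r v)) ⟩
          sum (λ r → sum (λ i → δ (index r) i * (a r * B r v)))
            ≈⟨ sum-cong-≋ (λ r → sum-δ (index r) (λ _ → a r * B r v)) ⟩
          dot a (points v)
            ≈⟨ aB≈0 v ⟩
          0# ∎

        component≈0 : ∀ i v → component i v ≈ 0#
        component≈0 = eigenspaces-independent laplacian eigval component
          (<⇒# ∘ increasing) component∈E ∑component≈0

        coefficients≈0 : ∀ i j → a (from (i , j)) ≈ 0#
        coefficients≈0 i = IsBasis.independent (isBasis i) (λ j → a (from (i , j))) (λ v → begin
          sum (λ j → a (from (i , j)) * basis i j v)
            ≈⟨ sum-cong-≋ (λ j → *-congˡ (B-from i j v)) ⟨
          sum (λ j → a (from (i , j)) * B (from (i , j)) v)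
            ≈⟨ sum-fibre i (λ r → a r * B r v) ⟩
          component (proj₁ i) v
            ≈⟨ component≈0 (proj₁ i) v ⟩
          0# ∎)

      -- All rows belong to nonzero eigenvalues, so they sum to zero and the points have centroid 0.
      -- A hyperplane through all points would contain 0, forcing `z` to be zero and contradicting
      -- independence of the rows.
      points-notInHyperplane : .{{_ : NonZero n}} →
        PointConfiguration.NotInHyperplane ℝ points
      points-notInHyperplane a z (r , aᵣ#0) aB≈z =
        #-irrefl (rows-independent a (λ v → ≈-trans (aB≈z v) z≈0) r) aᵣ#0
        where
        ∑B≈0 : ∀ r → sum (B r) ≈ 0#
        ∑B≈0 r = eigenvector-sum G (eigval-#0 (ℕ.≤-trans (s≤s z≤n) (proj₂ (proj₁ (to r)))))
          (B-eigenvector r)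

        z≈0 : z ≈ 0#
        z≈0 = #⇒≈0 (#-sym (<⇒# (0<fromℕ n))) (begin
          natural n * z                       ≈⟨ *-congʳ (sum-1 n) ⟨
          sum {n} (λ _ → 1#) * z              ≈⟨ *-distribʳ-sum {n} z (λ _ → 1#) ⟩
          sum {n} (λ _ → 1# * z)              ≈⟨ sum-cong-≋ {n} (λ v → ≈-trans (*-identityˡ z) (≈-sym (aB≈z v))) ⟩
          sum (λ v → dot a (points v))        ≈⟨ ∑-comm (λ v r → a r * B r v) ⟩
          sum (λ r → sum (λ v → a r * B r v)) ≈⟨ sum-cong-≋ (λ r → *-distribˡ-sum (a r) (B r)) ⟨
          sum (λ r → a r * sum (B r))         ≈⟨ dot-0ʳ a ∑B≈0 ⟩
          0#                                  ≈⟨ zeroˡ z ⟨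
          0# * z                              ∎)

      -- The row space of `B` contains the eigenspace, and a combination of rows is a linear
      -- functional evaluated on the columns.
      eigenvector-functional : ∀ (i : Above) {f} → E (proj₁ i) f →
        ∃[ a ] ∀ v → dot a (points v) ≈ f v
      eigenvector-functional i {f} Ef with IsBasis.spanning (isBasis i) f Ef
      ... | x , f≈xb = functional , λ v → begin
        sum (λ r → functional r * B r v)
          ≈⟨ sum-cong-≋ (λ r → *-distribʳ-sum (B r v) (λ j → δ (from (i , j)) r * x j)) ⟩
        sum (λ r → sum (λ j → δ (from (i , j)) r * x j * B r v))
          ≈⟨ ∑-comm (λ r j → δ (from (i , j)) r * x j * B r v) ⟩
        sum (λ j → sum (λ r → δ (from (i , j)) r * x j * B r v))
          ≈⟨ sum-cong-≋ (λ j → sum-cong-≋ (λ r → *-assoc (δ (from (i , j)) r) (x j) (B r v))) ⟩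
        sum (λ j → sum (λ r → δ (from (i , j)) r * (x j * B r v)))
          ≈⟨ sum-cong-≋ (λ j → sum-δ (from (i , j)) (λ r → x j * B r v)) ⟩
        sum (λ j → x j * B (from (i , j)) v)
          ≈⟨ sum-cong-≋ (λ j → *-congˡ (B-from i j v)) ⟩
        combination x (basis i) v
          ≈⟨ f≈xb v ⟨
        f v ∎
        where
        functional : Vector Carrier β
        -- The coordinates of `f`, placed at the rows of this eigenspace and zero at all others.
        functional r = sum (λ j → δ (from (i , j)) r * x j)

  -- Designs consisting of one vertex

  module _ {m : ℕ} {G : Graph (suc m)} {k : ℕ} (S : Laplacian.Spectrum ℝ G k) where
    open Laplacian ℝ G
    open Spectrum S
    open Design ℝ using (InSumUpTo; IsUniformlyWeightedDesign)

    singleton-design : ∀ {t} u → (∀ {f} → InSumUpTo S t f → sum f ≈ natural (suc m) * f u) →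
      IsUniformlyWeightedDesign S t ⁅ u ⁆
    singleton-design u average = (λ _ → 1#) , (1# , 0<1 , λ _ _ → ≈-refl) , λ f f∈ → begin
      recip (suc m) * sum f                       ≈⟨ *-congˡ (average f∈) ⟩
      recip (suc m) * (natural (suc m) * f u)     ≈⟨ *-assoc _ _ _ ⟨
      recip (suc m) * natural (suc m) * f u       ≈⟨ *-congʳ (recip-inverseˡ (suc m)) ⟩
      1# * f u                                    ≈⟨ sum-singleton u (λ w → 1# * f w) ⟨
      sum (λ w → if does (w ∈? ⁅ u ⁆) then 1# * f w else 0#) ∎

    design-average : ∀ {u t} →
      (∀ i → toℕ i ≤ t → ∀ {f} → E i f → sum f ≈ natural (suc m) * f u) →
      ∀ {f} → InSumUpTo S t f → sum f ≈ natural (suc m) * f u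
    design-average {u} {t} average {f} (g , g∈E , g≈0 , f≈∑g) = begin
      sum f                                       ≈⟨ sum-cong-≋ f≈∑g ⟩
      sum (λ v → sum (λ i → g i v))               ≈⟨ ∑-comm (λ v i → g i v) ⟩
      sum (λ i → sum (g i))                       ≈⟨ sum-cong-≋ component ⟩
      sum (λ i → natural (suc m) * g i u)         ≈⟨ *-distribˡ-sum (natural (suc m)) (λ i → g i u) ⟨
      natural (suc m) * sum (λ i → g i u)         ≈⟨ *-congˡ (f≈∑g u) ⟨
      natural (suc m) * f u                       ∎
      where
      component : ∀ i → sum (g i) ≈ natural (suc m) * g i u
      component i with toℕ i ℕ.≤? t
      ... | yes i≤t = average i i≤t (g∈E i i≤t)
      ... | no  i≰t = ≈-trans (sum-0 gᵢ≈0) (≈-sym (≈-trans (*-congˡ (gᵢ≈0 u)) (zeroʳ _)))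
        where
        gᵢ≈0 : ∀ v → g i v ≈ 0#
        gᵢ≈0 = g≈0 i (ℕ.≰⇒> i≰t)

  -- An eigenvector of a nonzero eigenvalue has sum zero, and on one vertex the sum is its only
  -- entry.
  spectrum-singleVertex : {G : Graph 1} {k : ℕ} → Laplacian.Spectrum ℝ G k → k ≡ 0
  spectrum-singleVertex {k = zero} S = ≡.refl
  spectrum-singleVertex {G} {suc k} S with Laplacian.Spectrum.sound S (suc zero)
  ... | f , (zero , f₀#0) , Ef = ⊥-elim (#-irrefl f₀≈0 f₀#0)
    where
    f₀≈0 : f zero ≈ 0#
    f₀≈0 = ≈-trans (≈-sym (+-identityʳ _)) (eigenvector-sum G (eigval-#0 S (s≤s z≤n)) Ef)

  -- Connected threshold graphs with at least two vertices

  module _ {m : ℕ} (G : Graph (suc (suc m))) (threshold : IsThreshold G) (connected : Connected G)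
           {k : ℕ} (S : Laplacian.Spectrum ℝ G k) where
    open Laplacian ℝ G
    open Spectrum S

    private
      N : ℕ
      N = suc (suc m)

      u : Fin N
      u = fromℕ (suc m)

      u~ : ∀ j → u ≢ j → Graph.Adj G u j
      u~ = connectedThreshold⇒lastAdj G threshold connected

    -- `peak` puts `N` somewhere in the list of eigenvalues; if it were not last, the last
    -- eigenvalue would exceed `N`.
    natural≈eigval-top : natural N ≈ eigval (fromℕ k)
    natural≈eigval-top with exhaustive (natural N) (natural-eigenvalue G u~ {zero} λ ())
    ... | i , N≈λᵢ with Fin.<-cmp i (fromℕ k)
    ...   | tri< i<k _ _    = ⊥-elim (natural≮eigenvalue G threshold (sound (fromℕ k))
                                (<-Order.<-respˡ-≈ (≈-sym N≈λᵢ) (increasing i<k)))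
    ...   | tri≈ _ ≡.refl _ = N≈λᵢ
    ...   | tri> _ _ k<i    = ⊥-elim (fromℕ-max i k<i)

    module _ {t : ℕ} (t<k : t ℕ.< k) where

      t<top : t ℕ.< toℕ (fromℕ k)
      t<top = ≡.subst (t ℕ.<_) (≡.sym (Fin.toℕ-fromℕ k)) t<k

      eigenspace-average : ∀ i → toℕ i ≤ t → ∀ {f} → E i f → sum f ≈ natural N * f u
      eigenspace-average i i≤t = eigenvector-average G u~ (eigval-cases i i≤t)
        where
        eigval-cases : ∀ i → toℕ i ≤ t → eigval i ≈ 0# ⊎ (eigval i # 0# × eigval i # natural N)
        eigval-cases zero    _   = inj₁ eigval₀
        -- As `t < k`, these eigenvalues lie strictly between 0 and the top one, which is `N`.
        eigval-cases (suc i) i<t = inj₂ (eigval-#0 S (s≤s z≤n) ,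
          <⇒# (<-Order.<-respʳ-≈ (≈-sym natural≈eigval-top) (increasing (ℕ.≤-<-trans i<t t<top))))

      last-design : Design.IsUniformlyWeightedDesign ℝ S t ⁅ u ⁆
      last-design = singleton-design S u (design-average S eigenspace-average)

      eigenconfiguration-twoValued : (𝓑 : Eigenconfiguration ℝ S t) →
        PointConfiguration.IsTwoValued ℝ (Eigenconfiguration.points 𝓑)
      eigenconfiguration-twoValued 𝓑
        -- As `t < k`, the top eigenspace is among those listed in `B`, so `peak` is a functional on
        -- the points. It is `N - 1` at `u` and `-1` at every other vertex, such as `zero`.
        with eigenvector-functional S 𝓑 (fromℕ k , t<top) {peak G u~}
               (λ i → ≈-trans (peak-eigenvector G u~ i) (*-congʳ natural≈eigval-top))
      ... | a , aB≈peak = points-notInHyperplane S 𝓑 ,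
        a , peak G u~ zero , peak G u~ u , peak-# G u~ {zero} (λ ()) ,
        (λ v → value v (u Fin.≟ v)) , (zero , aB≈peak zero) , (u , aB≈peak u)
        where
        value : ∀ v → Dec (u ≡ v) →
          dot a (Eigenconfiguration.points 𝓑 v) ≈ peak G u~ zero
          ⊎ dot a (Eigenconfiguration.points 𝓑 v) ≈ peak G u~ u
        value v (yes ≡.refl) = inj₂ (aB≈peak u)
        value v (no u≢v) = inj₁ (≈-trans (aB≈peak v) (+-cancelʳ 1# _ _
          (≈-trans (peak-≢ G u~ u≢v) (≈-sym (peak-≢ G u~ {zero} λ ())))))

theorem4p7 : ∀ {c ℓ₁ ℓ₂} (ℝ : RealNumbers c ℓ₁ ℓ₂)
    (m : ℕ) (G : Graph (suc m)) → IsThreshold G → Connected G →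
    (k : ℕ) (S : Laplacian.Spectrum ℝ G k) →
    (t : ℕ) → 1 ≤ t → t ≤ k ∸ 1 →
    Design.IsUniformlyWeightedDesign ℝ S t ⁅ fromℕ m ⁆
    × ((𝓑 : Eigenconfiguration ℝ S t) →
    PointConfiguration.IsTwoValued ℝ (Eigenconfiguration.points 𝓑))
-- Truncated subtraction gives `0 ∸ 1 = 0`, so no `t` is in range.
theorem4p7 ℝ m G threshold connected zero S t 1≤t t≤0 =
  ⊥-elim (ℕ.<⇒≱ 1≤t t≤0)
theorem4p7 ℝ zero G threshold connected (suc k) S t 1≤t t≤k
  with () ← spectrum-singleVertex ℝ S
-- Here `suc k ∸ 1` is `k`, so `s≤s t≤k` says that `t` lies strictly below the top index `suc k`.
theorem4p7 ℝ (suc m) G threshold connected (suc k) S t 1≤t t≤k =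
  last-design ℝ G threshold connected S (s≤s t≤k) ,
  eigenconfiguration-twoValued ℝ G threshold connected S (s≤s t≤k)
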